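{- Let $n$ be a positive integer. The map $\mathcal{C}:\{\text{abaci}\}\to\{\text{partitions}\}$ restricts to a bijection from the set of balanced flush abaci onto the set of symmetric $(2n)$-core partitions (types $\widetilde{C}/C$ and $\widetilde{B}/D$), and to a bijection from the set of even balanced flush abaci onto the set of even symmetric $(2n)$-core partitions (types $\widetilde{B}/B$ and $\widetilde{D}/D$).
   Context: Let $N=2n+1$. An abacus has $2n$ columns called runners $1,\dots,2n$; runner $i$ has entries labeled $mN+i$ for each level $m\in\mathbb{Z}$ (so the entries are the integers not divisible by $N$). Some entries are circled (beads); the others are gaps. Reading order is the order of the labels; "lowest" means largest label. The abacus is flush if no bead is preceded in reading order by a gap on the same runner. It is balanced if every runner has at least one bead and, for all $1\le i\le 2n$, the labels of the lowest beads on runners $i$ and $N-i$ sum to $N$. It is even if the number of gaps preceding $N$ in reading order is even. A bead is active if some gap (on any runner) precedes it in reading order. Partitions are identified with their diagrams ($\lambda_i$ boxes in row $i$, first row at the top). A partition is a $(2n)$-core if no box has hook length divisible by $2n$; symmetric if for every $i$ the length of its $i$-th row equals the length of its $i$-th column; even if it has an even number of boxes on the main diagonal. For an abacus $a$, $\mathcal{C}(a)$ is the partition whose southeast boundary is the lattice path obtained by reading the entries of $a$ in reading order, recording a north-step for each bead and an east-step for each gap. Equivalently, if $a$ has $M$ active beads, the $i$-th row of $\mathcal{C}(a)$ has as many boxes as there are gaps before the $(M-i+1)$-st active bead in reading order. -}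

module Defs where

open import Data.Bool using (Bool; true; false)
open import Data.Fin using (Fin; toℕ; opposite)
open import Data.Integer as ℤ using (ℤ; +_)
open import Data.List using (List; []; _∷_; length; filter; reverse; upTo)
open import Data.List.Membership.Propositional using (_∈_)
open import Data.List.Relation.Binary.Pointwise using (Pointwise)
open import Data.List.Relation.Unary.All using (All)
open import Data.List.Relation.Unary.Linked using (Linked)
open import Data.Nat using (ℕ; zero; suc; _+_; _*_; _∸_; _<_; _≥_; _<?_; NonZero)
open import Data.Nat.Divisibility using (_∣_)
open import Data.Product using (Σ; Σ-syntax; ∃-syntax; _×_; _,_; proj₁)
open import Function.Bundles using (Bijection; _⇔_)
open import Level using (0ℓ)
open import Relation.Binary.Bundles using (Setoid)
import Relation.Binary.Construct.On as On
open import Relation.Binary.PropositionalEquality using (_≡_; setoid; _→-setoid_)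
open import Relation.Nullary using (¬_)

-- Runners are 0-indexed: `runner = i` is the runner numbered `suc (toℕ i)`.
record Entry (n : ℕ) : Set where
  constructor entry
  field
    runner : Fin (2 * n)
    level  : ℤ

open Entry public

N : ℕ → ℕ
N n = suc (2 * n)

label : ∀ {n} → Entry n → ℤ
label {n} e = level e ℤ.* + N n ℤ.+ + suc (toℕ (runner e))

-- Reading order.
_≺_ : ∀ {n} → Entry n → Entry n → Set
e ≺ f = label e ℤ.< label f

-- `true` marks a bead and `false` a gap.  No finiteness is assumed.
Abacus : ℕ → Set
Abacus n = Entry n → Bool

Bead Gap Active : ∀ {n} → Abacus n → Entry n → Set
Bead   a e = a e ≡ true
Gap    a e = a e ≡ false
Active a e = Bead a e × (∃[ g ] (Gap a g × g ≺ e))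

Flush : ∀ {n} → Abacus n → Set
Flush a = ∀ g b → runner g ≡ runner b → Gap a g → Bead a b → ¬ (g ≺ b)

LowestBead : ∀ {n} → Abacus n → Fin (2 * n) → Entry n → Set
LowestBead a i b =
  runner b ≡ i × Bead a b ×
  (∀ c → runner c ≡ i → Bead a c → label c ℤ.≤ label b)

-- If i has number k then `opposite i` has number N - k.
Balanced : ∀ {n} → Abacus n → Set
Balanced {n} a =
  (∀ i → ∃[ b ] (runner b ≡ i × Bead a b)) ×
  (∀ i → ∃[ b ] ∃[ c ] (LowestBead a i b × LowestBead a (opposite i) c ×
                        label b ℤ.+ label c ≡ + N n))

-- The list contains exactly the entries satisfying P, each once, in
-- reading order.
Enumerates : ∀ {n} → (Entry n → Set) → List (Entry n) → Set
Enumerates P es = Linked _≺_ es × (∀ e → P e ⇔ e ∈ es)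

HasSize : ∀ {n} → (Entry n → Set) → ℕ → Set
HasSize P k = ∃[ es ] (Enumerates P es × length es ≡ k)

EvenAbacus : ∀ {n} → Abacus n → Set
EvenAbacus {n} a =
  ∃[ k ] (HasSize (λ g → Gap a g × label g ℤ.< + N n) k × 2 ∣ k)

record Partition : Set where
  field
    parts      : List ℕ
    decreasing : Linked _≥_ parts
    positive   : All NonZero parts

open Partition public

nth : List ℕ → ℕ → ℕ
nth []       _       = 0
nth (x ∷ _)  zero    = x
nth (_ ∷ xs) (suc i) = nth xs i

-- Rows and columns are 0-indexed, so box (i , j) lies in the diagram
-- exactly when j < row μ i.
row col : Partition → ℕ → ℕ
row μ i = nth (parts μ) i
col μ j = length (filter (j <?_) (parts μ))

hook : Partition → ℕ → ℕ → ℕ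
hook μ i j = suc ((row μ i ∸ suc j) + (col μ j ∸ suc i))

Core : ℕ → Partition → Set
Core t μ = ∀ i j → j < row μ i → ¬ (t ∣ hook μ i j)

Symmetric : Partition → Set
Symmetric μ = ∀ i → row μ i ≡ col μ i

EvenPartition : Partition → Set
EvenPartition μ =
  2 ∣ length (filter (λ i → i <? row μ i) (upTo (length (parts μ))))

-- The graph of 𝒞.  Since an arbitrary abacus may have infinitely many
-- active beads, or infinitely many gaps before one of them, 𝒞 is a partial
-- map on abaci.  If `es` lists the M active beads in reading order, the i-th
-- element of `reverse es` is the (M - i + 1)-st active bead.
𝒞 : ∀ {n} → Abacus n → Partition → Set
𝒞 a μ =
  ∃[ es ] (Enumerates (Active a) es ×
           Pointwise (λ b r → HasSize (λ g → Gap a g × g ≺ b) r)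
                     (reverse es) (parts μ))

-- Abaci are equal when they have the same beads; partitions are equal when
-- they have the same parts.
AbacusSetoid : ℕ → Setoid 0ℓ 0ℓ
AbacusSetoid n = Entry n →-setoid Bool

PartitionSetoid : Setoid 0ℓ 0ℓ
PartitionSetoid = On.setoid (setoid (List ℕ)) parts

Subsetoid : (S : Setoid 0ℓ 0ℓ) → (Setoid.Carrier S → Set) → Setoid 0ℓ 0ℓ
Subsetoid S P = On.setoid {B = Σ (Setoid.Carrier S) P} S proj₁

-- A bijection P → Q whose graph is exactly 𝒞 restricted to P; in
-- particular 𝒞 is defined and single-valued on P.
𝒞-RestrictsToBijection : ∀ {n} → (Abacus n → Set) → (Partition → Set) → Set
𝒞-RestrictsToBijection {n} P Q =
  Σ[ f ∈ Bijection (Subsetoid (AbacusSetoid n) P) (Subsetoid PartitionSetoid Q) ]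
    (∀ a (p : P a) μ →
      𝒞 a μ ⇔ Setoid._≈_ PartitionSetoid (proj₁ (Bijection.to f (a , p))) μ)

BalancedFlush EvenBalancedFlush : ∀ {n} → Abacus n → Set
BalancedFlush     a = Balanced a × Flush a
EvenBalancedFlush a = EvenAbacus a × BalancedFlush a

SymmetricCore EvenSymmetricCore : ℕ → Partition → Set
SymmetricCore     t μ = Symmetric μ × Core t μ
EvenSymmetricCore t μ = EvenPartition μ × SymmetricCore t μ

{-# OPTIONS --safe #-}
-- Number the entries consecutively in reading order by ℤ, the entries before
-- the label N being the negative ones, and call this number the position.  The
-- abacus of a partition with rows r and columns c has its beads at the
-- positions r i - (i + 1) and its gaps at the positions j - c j, and every
-- position is of exactly one of these forms.  The distance from the gap of
-- column j to the bead of row i is the hook length of the box (i , j), and two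
-- entries share a runner exactly when 2n divides their distance, so flush means
-- core.  The reflection x ↦ -1 - x of positions exchanges the bead of row i
-- with the gap of column i exactly when the partition is symmetric, and for
-- flush abaci this antisymmetry means balanced.  The diagonal boxes are the
-- gaps at negative positions.
module Submission where

open import Data.Bool using (Bool; true; false; not)
open import Data.Bool.Properties using (not-injective)
open import Data.Fin as Fin using (Fin; toℕ; fromℕ<; opposite)
import Data.Fin.Properties as Fin
open import Data.Integer as ℤ using (ℤ; +_; -[1+_]; _⊖_)
import Data.Integer.DivMod as ℤ
import Data.Integer.Divisibility.Signed as Signed
import Data.Integer.Properties as ℤ
import Data.Integer.Tactic.RingSolver as ℤ
open import Data.List
  using ([]; _∷_; length; filter; reverse; upTo; map; applyUpTo; applyDownFrom)
open import Data.List.Membership.Propositional using (_∈_)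
open import Data.List.Membership.Propositional.Properties
open import Data.List.Properties
open import Data.List.Relation.Binary.Pointwise using (Pointwise; []; _∷_)
open import Data.List.Relation.Unary.All as All using (All; []; _∷_)
import Data.List.Relation.Unary.All.Properties as All
open import Data.List.Relation.Unary.AllPairs using (AllPairs; []; _∷_)
open import Data.List.Relation.Unary.Any using (here; there)
open import Data.List.Relation.Unary.Linked as Linked using (Linked; []; [-]; _∷_)
import Data.List.Relation.Unary.Linked.Properties as Linked
open import Data.Nat
open import Data.Nat.Divisibility using (_∣_; divides)
open import Data.Nat.Properties
open import Data.Nat.Tactic.RingSolver using (solve-∀)
open import Data.Product using (∃-syntax; _×_; _,_; proj₁; proj₂)
open import Data.Sum using (_⊎_; inj₁; inj₂; [_,_]′)
open import Function using (_∘_; const; mk⇔; Equivalence)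
open import Level using (0ℓ)
open import Relation.Binary.Core using (Rel)
open import Relation.Binary.Definitions using (Transitive; Irreflexive; tri<; tri≈; tri>)
open import Relation.Binary.PropositionalEquality
open import Relation.Nullary using (¬_; yes; no; contradiction)
open import Defs

-- Self-conjugate row functions

-- The diagram with row lengths `r` is closed under transposition. Its rows being initial segments,
-- this makes `r` antitone and zero from index `r 0` on.
SelfConjugate : (ℕ → ℕ) → Set
SelfConjugate r = ∀ {i j} → j < r i → i < r j

-- By symmetry the row lengths r also serve as the column lengths.
beadPos gapPos : (ℕ → ℕ) → ℕ → ℤ
beadPos r i = r i ⊖ suc i
gapPos  r j = j ⊖ r j

⊖-mono-< : ∀ m n p q → m + q < p + n → m ⊖ n ℤ.< p ⊖ q
⊖-mono-< m n p q lt = subst₂ ℤ._<_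
  (trans (cong (_⊖ (q + n)) (+-comm m q)) (ℤ.+-cancelˡ-⊖ q m n))
  (trans (cong₂ _⊖_ (+-comm p n) (+-comm q n)) (ℤ.+-cancelˡ-⊖ n p q))
  (ℤ.⊖-monoˡ-< (q + n) lt)

⊖-cong : ∀ m n p q → m + q ≡ p + n → m ⊖ n ≡ p ⊖ q
⊖-cong m n p q eq = begin
  m ⊖ n              ≡⟨ ℤ.+-cancelˡ-⊖ q m n ⟨
  (q + m) ⊖ (q + n)  ≡⟨ cong₂ _⊖_ (trans (+-comm q m) (trans eq (+-comm p n))) (+-comm q n) ⟩
  (n + p) ⊖ (n + q)  ≡⟨ ℤ.+-cancelˡ-⊖ n p q ⟩
  p ⊖ q              ∎
  where open ≡-Reasoning

-- The centre of a balanced abacus lies between the positions -1 and 0.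
reflect : ℤ → ℤ
reflect x = ℤ.pred (ℤ.- x)

reflect-⊖ : ∀ m n → reflect (m ⊖ n) ≡ n ⊖ suc m
reflect-⊖ m n = trans (cong ℤ.pred (sym (ℤ.⊖-swap n m))) (ℤ.distribʳ-⊖-+-neg 0 n m)

reflect-gapPos : ∀ r j → reflect (gapPos r j) ≡ beadPos r j
reflect-gapPos r j = reflect-⊖ j (r j)

reflect-beadPos : ∀ r i → reflect (beadPos r i) ≡ gapPos r i
reflect-beadPos r i = trans (reflect-⊖ (r i) (suc i)) (ℤ.[1+m]⊖[1+n]≡m⊖n i (r i))

module _ {r : ℕ → ℕ} (sc : SelfConjugate r) where

  private
    b = beadPos r
    g = gapPos r

  -- If `r i < r j`, the box `(j , r i)` transposes into row `r i`, which is therefore longer than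
  -- `j` and so than `i`. Transposing back would put column `r i` into row `i`.
  antitone : ∀ {i j} → i ≤ j → r j ≤ r i
  antitone i≤j = ≮⇒≥ λ ri<rj → <-irrefl refl (sc (≤-<-trans i≤j (sc ri<rj)))

  r≡0 : ∀ {i} → r 0 ≤ i → r i ≡ 0
  r≡0 {i} r0≤i = n≤0⇒n≡0 (≮⇒≥ λ 0<ri → <⇒≱ (sc 0<ri) r0≤i)

  -- The inequalities for a box and its transpose add up to `j + suc i < r i + r j`. For a non-box
  -- both reverse, and the strictness in `¬box⇒bead<gap` comes from the `suc i` in `beadPos`. Hence
  -- the order of a bead and a gap decides the box, and the two never coincide.
  box⇒gap<bead : ∀ {i j} → j < r i → g j ℤ.< b i
  box⇒gap<bead {i} {j} j<ri = ⊖-mono-< j (r j) (r i) (suc i)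
    (+-mono-≤ j<ri (sc j<ri))

  ¬box⇒bead<gap : ∀ {i j} → ¬ j < r i → b i ℤ.< g j
  ¬box⇒bead<gap {i} {j} j≮ri = ⊖-mono-< (r i) (suc i) j (r j)
    (subst (suc (r i + r j) ≤_) (sym (+-suc j i))
      (s≤s (+-mono-≤ (≮⇒≥ j≮ri) (≮⇒≥ λ i<rj → j≮ri (sc i<rj)))))

  gap<bead⇒box : ∀ {i j} → g j ℤ.< b i → j < r i
  gap<bead⇒box {i} {j} lt with j <? r i
  ... | yes j<ri = j<ri
  ... | no  j≮ri = contradiction (¬box⇒bead<gap j≮ri) (ℤ.<-asym lt)

  bead≢gap : ∀ {i j} → b i ≢ g j
  bead≢gap {i} {j} eq with j <? r i
  ... | yes j<ri = ℤ.<-irrefl (sym eq) (box⇒gap<bead j<ri)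
  ... | no  j≮ri = ℤ.<-irrefl eq (¬box⇒bead<gap j≮ri)

  bead-decreasing : ∀ i → b (suc i) ℤ.< b i
  bead-decreasing i = ⊖-mono-< (r (suc i)) (2 + i) (r i) (suc i)
    (subst (_≤ r i + (2 + i)) (+-suc (r (suc i)) (suc i))
      (+-monoˡ-≤ (2 + i) (antitone (n≤1+n i))))

  gap-increasing : ∀ j → g j ℤ.< g (suc j)
  gap-increasing j = ⊖-mono-< j (r j) (suc j) (r (suc j))
    (s≤s (+-monoʳ-≤ j (antitone (n≤1+n j))))

  classify⁺ : ∀ k → (∃[ i ] + k ≡ b i) ⊎ (∃[ j ] + k ≡ g j)
  classify⁺ k = search (r 0) 0 (m≤m+n (r 0) 0) z≤n
    where
    -- Finds the first row i with r i ≤ k + i + 1: position k is its bead in case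
    -- of equality, and the gap of column k + i otherwise.
    search : ∀ fuel i → r 0 ≤ fuel + i → i ≤ r (k + i) →
             (∃[ i ] + k ≡ b i) ⊎ (∃[ j ] + k ≡ g j)
    search fuel i bound i≤r with <-cmp (r i) (suc (k + i))
    -- Column `k + i` has length at least `i` by the invariant and at most `i` because row `i` does
    -- not reach it, so its gap is at `(k + i) - i`.
    ... | tri< ri≤k+i _ _ = inj₂ (k + i , ⊖-cong k 0 (k + i) (r (k + i))
            (trans (cong (_+_ k) (≤-antisym (≮⇒≥ (λ lt → <⇒≱ (sc lt) (s≤s⁻¹ ri≤k+i))) i≤r))
                   (sym (+-identityʳ (k + i)))))
    ... | tri≈ _ ri≡ _ = inj₁ (i , ⊖-cong k 0 (r i) (suc i)
            (trans (+-suc k i) (trans (sym ri≡) (sym (+-identityʳ (r i))))))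
    -- Out of fuel, `r i ≤ r 0 ≤ i`, too short for a row longer than `k + i + 1`.
    search zero i bound i≤r | tri> _ _ ri> =
      contradiction (≤-trans (antitone z≤n) bound) (<⇒≱ (≤-<-trans (m≤n⇒m≤1+n (m≤n+m i k)) ri>))
    search (suc fuel) i bound i≤r | tri> _ _ ri> =
      search fuel (suc i) (subst (r 0 ≤_) (sym (+-suc fuel i)) bound)
        (sc (subst (_< r i) (sym (+-suc k i)) ri>))

  reflect-classified : ∀ {x} → (∃[ i ] x ≡ b i) ⊎ (∃[ j ] x ≡ g j) →
    (∃[ i ] reflect x ≡ b i) ⊎ (∃[ j ] reflect x ≡ g j)
  reflect-classified (inj₁ (i , refl)) = inj₂ (i , reflect-beadPos r i)
  reflect-classified (inj₂ (j , refl)) = inj₁ (j , reflect-gapPos r j)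

  -- Reflection exchanges bead and gap positions and sends `+ k` to `-[1+ k ]`, which reduces the
  -- negative positions to the nonnegative ones.
  classify : ∀ x → (∃[ i ] x ≡ b i) ⊎ (∃[ j ] x ≡ g j)
  classify (+ k)    = classify⁺ k
  classify -[1+ k ] = subst (λ x → (∃[ i ] x ≡ b i) ⊎ (∃[ j ] x ≡ g j))
    (reflect-⊖ k 0) (reflect-classified (classify⁺ k))

  diagonal : ∀ {j} → j < r j → g j ℤ.< + 0
  diagonal {j} j<rj = ⊖-mono-< j (r j) 0 0 (subst (_< r j) (sym (+-identityʳ j)) j<rj)

  diagonal⁻ : ∀ {j} → g j ℤ.< + 0 → j < r j
  diagonal⁻ {j} lt = ≰⇒> λ rj≤j →
    ℤ.<⇒≱ lt (subst (+ 0 ℤ.≤_) (sym (ℤ.⊖-≥ rj≤j)) (ℤ.+≤+ z≤n))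

-- Adds a hook with arm and leg K around the diagram of r.
addHook : ℕ → (ℕ → ℕ) → ℕ → ℕ
addHook K r zero    = suc K
addHook K r (suc i) with i <? K
... | yes _ = suc (r i)
... | no  _ = 0

addHook-inner : ∀ {K r i} → i < K → addHook K r (suc i) ≡ suc (r i)
addHook-inner {K} {r} {i} i<K with i <? K
... | yes _   = refl
... | no  i≮K = contradiction i<K i≮K

-- By `r 0 ≤ K` the old diagram lies in the first `K` rows and columns, so the arm and the leg of
-- the symmetric new hook reach past it and no old row is cut off.
addHook-selfConjugate : ∀ {K r} → SelfConjugate r → r 0 ≤ K → SelfConjugate (addHook K r)
addHook-selfConjugate sc r0≤K {zero} {zero} lt = lt
addHook-selfConjugate {K} sc r0≤K {zero} {suc j} lt with j <? K
... | yes _   = s≤s z≤n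
... | no  j≮K = contradiction (s≤s⁻¹ lt) j≮K
addHook-selfConjugate {K} sc r0≤K {suc i} {zero} lt with i <? K
... | yes i<K = s≤s i<K
addHook-selfConjugate {K} {r} sc r0≤K {suc i} {suc j} lt with i <? K
... | yes i<K with j <? K
...   | yes _   = s≤s (sc (s≤s⁻¹ lt))
...   | no  j≮K = contradiction (<-≤-trans (sc (≤-<-trans z≤n (sc (s≤s⁻¹ lt)))) r0≤K) j≮K

-- The row function of an antisymmetric bead pattern

module _ {s : ℤ → Bool} (anti : ∀ x → s (reflect x) ≡ not (s x)) where

  -- The bead of row `j` is the reflection of the gap of column `j`; the constructions below
  -- therefore only keep track of beads.
  gap-from-bead : ∀ r {j} → s (beadPos r j) ≡ true → s (gapPos r j) ≡ false
  gap-from-bead r {j} eq = not-injective (begin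
    not (s (gapPos r j))       ≡⟨ anti (gapPos r j) ⟨
    s (reflect (gapPos r j))   ≡⟨ cong s (reflect-gapPos r j) ⟩
    s (beadPos r j)            ≡⟨ eq ⟩
    true                       ∎)
    where open ≡-Reasoning

  -- An empty row `i` has its bead at `-1 - i`, the reflection of `i`.
  bead-beyond : ∀ {r i} → r i ≡ 0 → s (+ i) ≡ false → s (beadPos r i) ≡ true
  bead-beyond {r} {i} ri≡0 eq = begin
    s (r i ⊖ suc i)    ≡⟨ cong (λ m → s (m ⊖ suc i)) ri≡0 ⟩
    s (0 ⊖ suc i)      ≡⟨ cong s (reflect-⊖ i 0) ⟨
    s (reflect (+ i))  ≡⟨ anti (+ i) ⟩
    not (s (+ i))      ≡⟨ cong not eq ⟩
    true               ∎
    where open ≡-Reasoning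

  -- The beads at nonnegative positions are the Frobenius coordinates of the
  -- partition, whose diagonal hooks are added from the inside out.
  window-rows : ∀ K → ∃[ r ] (SelfConjugate r × r 0 ≤ K ×
                              (∀ {i} → i < K → s (beadPos r i) ≡ true))
  window-rows zero = (λ _ → 0) , (λ ()) , z≤n , λ ()
  window-rows (suc K) with window-rows K | s (+ K) in sK
  -- No bead at `+ K` means no new hook: row `K` is empty because `r 0 ≤ K`.
  ... | r , sc , r0≤K , beads | false = r , sc , m≤n⇒m≤1+n r0≤K , beads′
    where
    beads′ : ∀ {i} → i < suc K → s (beadPos r i) ≡ true
    beads′ i<1+K with m<1+n⇒m<n∨m≡n i<1+K
    ... | inj₁ i<K  = beads i<K
    ... | inj₂ refl = bead-beyond {r} (r≡0 sc r0≤K) sK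
  -- A bead at `+ K` becomes the bead of a new first row of length `K + 1`.
  ... | r , sc , r0≤K , beads | true =
    addHook K r , addHook-selfConjugate sc r0≤K , ≤-refl , beads′
    where
    beads′ : ∀ {i} → i < suc K → s (beadPos (addHook K r) i) ≡ true
    beads′ {zero} _ = sK
    -- An old row gains one box and moves down one row, so its bead stays in place.
    beads′ {suc i} (s≤s i<K) = trans
      (cong s (trans (cong (_⊖ (2 + i)) (addHook-inner i<K))
                     (ℤ.[1+m]⊖[1+n]≡m⊖n (r i) (suc i))))
      (beads i<K)

  -- The rows from index `K` on are empty, and the gaps at `+ K` and beyond reflect to their beads.
  rows : ∀ K → (∀ k → K ≤ k → s (+ k) ≡ false) →
         ∃[ r ] (SelfConjugate r × (∀ i → s (beadPos r i) ≡ true))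
  rows K vanish with window-rows K
  ... | r , sc , r0≤K , beads = r , sc , all
    where
    all : ∀ i → s (beadPos r i) ≡ true
    all i with i <? K
    ... | yes i<K = beads i<K
    ... | no  i≮K = bead-beyond {r} (r≡0 sc (≤-trans r0≤K (≮⇒≥ i≮K))) (vanish i (≮⇒≥ i≮K))

-- Positions of entries

-- Comparison by leading digit in base `d`. It serves labels with `d = N n`, whose remainders run
-- from `1` to `2 * n`, and positions with `d = 2 * n`, whose remainders start at `0`.
digit-< : ∀ d a b {i} j → i < d → a ℤ.< b → a ℤ.* + d ℤ.+ + i ℤ.< b ℤ.* + d ℤ.+ + j
digit-< d a b {i} j i<d a<b = begin-strict
  a ℤ.* + d ℤ.+ + i  <⟨ ℤ.+-monoʳ-< (a ℤ.* + d) (ℤ.+<+ i<d) ⟩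
  a ℤ.* + d ℤ.+ + d  ≡⟨ ℤ.+-comm (a ℤ.* + d) (+ d) ⟩
  + d ℤ.+ a ℤ.* + d  ≡⟨ ℤ.suc-* a (+ d) ⟨
  ℤ.suc a ℤ.* + d    ≤⟨ ℤ.*-monoʳ-≤-nonNeg (+ d) (ℤ.i<j⇒suc[i]≤j a<b) ⟩
  b ℤ.* + d          ≤⟨ ℤ.i≤i+j (b ℤ.* + d) (+ j) ⟩
  b ℤ.* + d ℤ.+ + j  ∎
  where open ℤ.≤-Reasoning

digit-<⁻ : ∀ d a b {i j} → j < d → a ℤ.* + d ℤ.+ + i ℤ.< b ℤ.* + d ℤ.+ + j →
           a ℤ.< b ⊎ (a ≡ b × i < j)
digit-<⁻ d a b {i} {j} j<d lt with ℤ.<-cmp a b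
... | tri< a<b _ _  = inj₁ a<b
... | tri≈ _ refl _ = inj₂ (refl , ≰⇒> λ j≤i →
        ℤ.<⇒≱ lt (ℤ.+-monoʳ-≤ (a ℤ.* + d) (ℤ.+≤+ j≤i)))
... | tri> _ _ b<a  = contradiction (digit-< d b a i j<d b<a) (ℤ.<-asym lt)

-- Numbers the entries consecutively in reading order, starting from 0 at the
-- first entry after the label N.
pos : ∀ {n} → Entry n → ℤ
pos {n} e = ℤ.pred (level e) ℤ.* + (2 * n) ℤ.+ + toℕ (runner e)

ℤpred-mono-< : ∀ {a b} → a ℤ.< b → ℤ.pred a ℤ.< ℤ.pred b
ℤpred-mono-< = ℤ.+-monoʳ-< ℤ.-1ℤ

ℤpred-cancel-< : ∀ {a b} → ℤ.pred a ℤ.< ℤ.pred b → a ℤ.< b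
ℤpred-cancel-< {a} {b} lt = ℤ.≰⇒> λ b≤a → ℤ.<⇒≱ lt (ℤ.pred-mono b≤a)

ℤpred-injective : ∀ {a b} → ℤ.pred a ≡ ℤ.pred b → a ≡ b
ℤpred-injective {a} {b} eq = trans (sym (ℤ.suc-pred a)) (trans (cong ℤ.suc eq) (ℤ.suc-pred b))

module _ {n : ℕ} where

  private
    w = 2 * n

  -- Labels and positions both order the entries lexicographically by level and runner.
  ≺⇒pos< : ∀ {e f : Entry n} → e ≺ f → pos e ℤ.< pos f
  ≺⇒pos< {e} {f} lt with digit-<⁻ (N n) (level e) (level f) (s≤s (Fin.toℕ<n (runner f))) lt
  ... | inj₁ l<l          = digit-< w (ℤ.pred (level e)) (ℤ.pred (level f)) _ (Fin.toℕ<n (runner e))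
                              (ℤpred-mono-< l<l)
  ... | inj₂ (l≡l , r<r) rewrite l≡l =
    ℤ.+-monoʳ-< (ℤ.pred (level f) ℤ.* + w) (ℤ.+<+ (s≤s⁻¹ r<r))

  pos<⇒≺ : ∀ {e f : Entry n} → pos e ℤ.< pos f → e ≺ f
  pos<⇒≺ {e} {f} lt with digit-<⁻ w (ℤ.pred (level e)) (ℤ.pred (level f)) (Fin.toℕ<n (runner f)) lt
  ... | inj₁ l<l = digit-< (N n) (level e) (level f) _ (s≤s (Fin.toℕ<n (runner e)))
                     (ℤpred-cancel-< {level e} {level f} l<l)
  ... | inj₂ (l≡l , r<r) rewrite ℤpred-injective {level e} {level f} l≡l =
    ℤ.+-monoʳ-< (level f ℤ.* + N n) (ℤ.+<+ (s≤s r<r))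

  level-<⇒≺ : ∀ {e f : Entry n} → level e ℤ.< level f → e ≺ f
  level-<⇒≺ {e} {f} = digit-< (N n) (level e) (level f) _ (s≤s (Fin.toℕ<n (runner e)))

  precedes-N⇒pos<0 : ∀ {e : Entry n} → label e ℤ.< + N n → pos e ℤ.< + 0
  -- `+ N n` is read as level `1` with remainder `0`, so the case of equal levels is empty.
  precedes-N⇒pos<0 {e} lt with digit-<⁻ (N n) (level e) (+ 1) {j = 0} (s≤s z≤n)
    (subst (label e ℤ.<_) (sym (trans (ℤ.+-identityʳ _) (ℤ.*-identityˡ (+ N n)))) lt)
  ... | inj₁ l<1 = digit-< w (ℤ.pred (level e)) (+ 0) 0 (Fin.toℕ<n (runner e)) (ℤpred-mono-< l<1)

  pos<0⇒precedes-N : ∀ {e : Entry n} → pos e ℤ.< + 0 → label e ℤ.< + N n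
  pos<0⇒precedes-N {e} lt = subst (label e ℤ.<_)
    (trans (ℤ.+-identityʳ _) (ℤ.*-identityˡ (+ N n)))
    (digit-< (N n) (level e) (+ 1) 0 (s≤s (Fin.toℕ<n (runner e))) l<1)
    where
    l<1 : level e ℤ.< + 1
    l<1 = ℤ.≰⇒> λ 1≤l → ℤ.<⇒≱ lt (ℤ.+-mono-≤
      (ℤ.*-monoʳ-≤-nonNeg (+ w) (ℤ.pred-mono 1≤l)) (ℤ.+≤+ z≤n))

  pos-injective : ∀ {e f : Entry n} → pos e ≡ pos f → e ≡ f
  pos-injective {entry i a} {entry j b} eq with ℤ.<-cmp a b
  ... | tri< a<b _ _ =
    contradiction (digit-< w (ℤ.pred a) (ℤ.pred b) _ (Fin.toℕ<n i) (ℤpred-mono-< a<b)) (ℤ.<-irrefl eq)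
  ... | tri> _ _ b<a =
    contradiction (digit-< w (ℤ.pred b) (ℤ.pred a) _ (Fin.toℕ<n j) (ℤpred-mono-< b<a)) (ℤ.<-irrefl (sym eq))
  ... | tri≈ _ refl _ = cong (λ k → entry k a) (Fin.toℕ-injective (≤-antisym (leq eq) (leq (sym eq))))
    where
    leq : ∀ {i j} → ℤ.pred a ℤ.* + w ℤ.+ + i ≡ ℤ.pred a ℤ.* + w ℤ.+ + j → i ≤ j
    leq eq = ≮⇒≥ λ j<i → ℤ.<-irrefl (sym eq) (ℤ.+-monoʳ-< (ℤ.pred a ℤ.* + w) (ℤ.+<+ j<i))

  -- Position `0` starts level `1`, so the reflection of positions exchanges levels `0` and `1`. In
  -- a balanced flush abacus a lowest bead goes to the first gap of the opposite runner, one level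
  -- after the lowest bead there.
  mirror : Entry n → Entry n
  mirror e = entry (opposite (runner e)) (+ 1 ℤ.- level e)

  opposite-+ : ∀ (i : Fin w) → toℕ (opposite i) + suc (toℕ i) ≡ w
  opposite-+ i = trans (cong (_+ suc (toℕ i)) (Fin.opposite-prop i)) (m∸n+n≡m (Fin.toℕ<n i))

  pos-mirror : ∀ e → pos (mirror e) ≡ reflect (pos e)
  -- Writing the width as `toℕ (opposite i) + suc (toℕ i)` leaves a polynomial identity.
  pos-mirror (entry i m) = subst
    (λ W → ℤ.pred (+ 1 ℤ.- m) ℤ.* W ℤ.+ + toℕ (opposite i) ≡ reflect (ℤ.pred m ℤ.* W ℤ.+ + toℕ i))
    (cong +_ (opposite-+ i)) (identity m (+ toℕ (opposite i)) (+ toℕ i))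
    where
    identity : ∀ m k i → (ℤ.-1ℤ ℤ.+ (+ 1 ℤ.- m)) ℤ.* (k ℤ.+ (+ 1 ℤ.+ i)) ℤ.+ k ≡
                         ℤ.-1ℤ ℤ.+ ℤ.- ((ℤ.-1ℤ ℤ.+ m) ℤ.* (k ℤ.+ (+ 1 ℤ.+ i)) ℤ.+ i)
    identity = ℤ.solve-∀

  lower : ℤ → Entry n → Entry n
  lower q e = entry (runner e) (level e ℤ.+ q)

  pos-lower : ∀ q e → pos (lower q e) ≡ pos e ℤ.+ q ℤ.* + w
  pos-lower q e = identity (level e) q (+ w) (+ toℕ (runner e))
    where
    identity : ∀ l q W i → (ℤ.-1ℤ ℤ.+ (l ℤ.+ q)) ℤ.* W ℤ.+ i ≡ (ℤ.-1ℤ ℤ.+ l) ℤ.* W ℤ.+ i ℤ.+ q ℤ.* W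
    identity = ℤ.solve-∀

  sameRunner⇒∣ : ∀ {e f : Entry n} {h} → runner e ≡ runner f → pos f ≡ pos e ℤ.+ + h → w ∣ h
  sameRunner⇒∣ {e} {f} {h} eq shift = Signed.∣⇒∣ᵤ (Signed.divides q (begin
    + h                               ≡⟨ ℤ.+-identityʳ (+ h) ⟨
    + h ℤ.+ + 0                       ≡⟨ cancel (pos e) (+ h) ⟩
    pos e ℤ.+ + h ℤ.- pos e           ≡⟨ cong (ℤ._- pos e) shift ⟨
    pos f ℤ.- pos e                   ≡⟨ cong (λ x → pos x ℤ.- pos e) f≡ ⟩
    pos (lower q e) ℤ.- pos e         ≡⟨ cong (ℤ._- pos e) (pos-lower q e) ⟩
    pos e ℤ.+ q ℤ.* + w ℤ.- pos e     ≡⟨ cancel (pos e) (q ℤ.* + w) ⟨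
    q ℤ.* + w ℤ.+ + 0                 ≡⟨ ℤ.+-identityʳ (q ℤ.* + w) ⟩
    q ℤ.* + w                         ∎))
    where
    open ≡-Reasoning
    q = level f ℤ.- level e
    cancel : ∀ p x → x ℤ.+ + 0 ≡ p ℤ.+ x ℤ.- p
    cancel = ℤ.solve-∀
    difference : ∀ l m → m ≡ l ℤ.+ (m ℤ.- l)
    difference = ℤ.solve-∀
    f≡ : f ≡ lower q e
    f≡ = cong₂ entry (sym eq) (difference (level e) (level f))

  -- Moving `e` by `q` levels, with `q` the quotient, leads to the position of `f`, and positions
  -- determine entries.
  ∣⇒sameRunner : ∀ {e f : Entry n} {h} → w ∣ h → pos f ≡ pos e ℤ.+ + h → runner e ≡ runner f
  ∣⇒sameRunner {e} {f} {h} (divides q eq) shift = sym (cong runner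
    (pos-injective {f} {lower (+ q) e} (begin
      pos f                      ≡⟨ shift ⟩
      pos e ℤ.+ + h              ≡⟨ cong (λ k → pos e ℤ.+ + k) eq ⟩
      pos e ℤ.+ + (q * w)        ≡⟨ cong (ℤ._+_ (pos e)) (ℤ.pos-* q w) ⟩
      pos e ℤ.+ + q ℤ.* + w      ≡⟨ pos-lower (+ q) e ⟨
      pos (lower (+ q) e)        ∎)))
    where open ≡-Reasoning

module _ {n : ℕ} .{{_ : NonZero n}} where

  private
    w = 2 * n
    instance
      w≢0 : NonZero w
      w≢0 = m*n≢0 2 n

  entryAt : ℤ → Entry n
  entryAt x = entry (fromℕ< (ℤ.n%ℕd<d x w)) (ℤ.suc (x ℤ./ℕ w))

  pos-entryAt : ∀ x → pos (entryAt x) ≡ x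
  pos-entryAt x = begin
    ℤ.pred (ℤ.suc q) ℤ.* + w ℤ.+ + toℕ (fromℕ< (ℤ.n%ℕd<d x w))
      ≡⟨ cong₂ (λ a b → a ℤ.* + w ℤ.+ + b) (ℤ.pred-suc q) (Fin.toℕ-fromℕ< (ℤ.n%ℕd<d x w)) ⟩
    q ℤ.* + w ℤ.+ + (x ℤ.%ℕ w)
      ≡⟨ ℤ.+-comm (q ℤ.* + w) _ ⟩
    + (x ℤ.%ℕ w) ℤ.+ q ℤ.* + w
      ≡⟨ ℤ.a≡a%ℕn+[a/ℕn]*n x w ⟨
    x ∎
    where
    open ≡-Reasoning
    q = x ℤ./ℕ w

  entryAt-pos : ∀ {e x} → pos e ≡ x → e ≡ entryAt x
  entryAt-pos {e} {x} eq = pos-injective (trans eq (sym (pos-entryAt x)))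

-- Uniqueness of enumerations and of the values of `𝒞`

module _ {A : Set} {R : Rel A 0ℓ} (R-trans : Transitive R) (R-irrefl : Irreflexive _≡_ R) where

  -- If the heads differed, each would occur in the tail of the other list and so lie strictly above
  -- the other head.
  ascending-unique : ∀ {xs ys} → AllPairs R xs → AllPairs R ys →
    (∀ {x} → x ∈ xs → x ∈ ys) → (∀ {x} → x ∈ ys → x ∈ xs) → xs ≡ ys
  ascending-unique [] [] _ _ = refl
  ascending-unique [] (_ ∷ _) _ ys⊆ = contradiction (ys⊆ (here refl)) λ ()
  ascending-unique (_ ∷ _) [] xs⊆ _ = contradiction (xs⊆ (here refl)) λ ()
  ascending-unique {x ∷ xs} {y ∷ ys} (x<xs ∷ <xs) (y<ys ∷ <ys) xs⊆ ys⊆ =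
    cong₂ _∷_ x≡y (ascending-unique <xs <ys
      (tail-⊆ x≡y x<xs xs⊆) (tail-⊆ (sym x≡y) y<ys ys⊆))
    where
    x≡y : x ≡ y
    x≡y with xs⊆ (here refl) | ys⊆ (here refl)
    ... | here eq   | _         = eq
    ... | there _   | here eq   = sym eq
    ... | there x∈  | there y∈  =
      contradiction (R-trans (All.lookup y<ys x∈) (All.lookup x<xs y∈)) (R-irrefl refl)

    tail-⊆ : ∀ {x y xs ys} → x ≡ y → All (R x) xs → (∀ {z} → z ∈ x ∷ xs → z ∈ y ∷ ys) →
             ∀ {z} → z ∈ xs → z ∈ ys
    tail-⊆ refl x<xs ⊆ z∈ with ⊆ (there z∈)
    ... | here refl = contradiction (All.lookup x<xs z∈) (R-irrefl refl)
    ... | there z∈′ = z∈′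

module _ {n : ℕ} where

  Enumerates-unique : ∀ {P : Entry n → Set} {es fs} → Enumerates P es → Enumerates P fs → es ≡ fs
  Enumerates-unique (asc , P⇔) (asc′ , P⇔′) = ascending-unique {R = _≺_} ℤ.<-trans
    (λ { refl → ℤ.<-irrefl refl })
    (Linked.Linked⇒AllPairs ℤ.<-trans asc) (Linked.Linked⇒AllPairs ℤ.<-trans asc′)
    (λ {e} e∈ → Equivalence.to (P⇔′ e) (Equivalence.from (P⇔ e) e∈))
    (λ {e} e∈ → Equivalence.to (P⇔ e) (Equivalence.from (P⇔′ e) e∈))

  HasSize-unique : ∀ {P : Entry n → Set} {k l} → HasSize P k → HasSize P l → k ≡ l
  HasSize-unique (_ , enum , refl) (_ , enum′ , refl) = cong length (Enumerates-unique enum enum′)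

  𝒞-functional : ∀ {a : Abacus n} {μ ν} → 𝒞 a μ → 𝒞 a ν → parts μ ≡ parts ν
  𝒞-functional {a} (es , enum , sizes) (fs , enum′ , sizes′)
    with refl ← Enumerates-unique enum enum′ = unique sizes sizes′
    where
    unique : ∀ {bs ks ls} → Pointwise (λ b r → HasSize (λ g → Gap a g × g ≺ b) r) bs ks →
             Pointwise (λ b r → HasSize (λ g → Gap a g × g ≺ b) r) bs ls → ks ≡ ls
    unique [] [] = refl
    unique (k ∷ ks) (l ∷ ls) = cong₂ _∷_ (HasSize-unique k l) (unique ks ls)

-- Symmetric partitions and self-conjugate row functions

nth-bounded : ∀ {x xs} → Linked _≥_ (x ∷ xs) → ∀ i → nth xs i ≤ x
nth-bounded [-] i = z≤n
nth-bounded (x≥y ∷ _) zero = x≥y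
nth-bounded (x≥y ∷ dec) (suc i) = ≤-trans (nth-bounded dec i) x≥y

-- In a decreasing list the parts exceeding `j` form an initial segment, so their number tells which
-- rows meet column `j`.
box⇒<col : ∀ {xs} → Linked _≥_ xs → ∀ {i j} → j < nth xs i → i < length (filter (j <?_) xs)
box⇒<col {x ∷ xs} dec {zero} {j} j<x
  rewrite filter-accept (j <?_) {x} {xs} j<x = s≤s z≤n
box⇒<col {x ∷ xs} dec {suc i} {j} j<r
  rewrite filter-accept (j <?_) {x} {xs} (<-≤-trans j<r (nth-bounded dec i)) =
  s≤s (box⇒<col (Linked.tail dec) j<r)

<col⇒box : ∀ {xs} → Linked _≥_ xs → ∀ {i j} → i < length (filter (j <?_) xs) → j < nth xs i
<col⇒box {x ∷ xs} dec {i} {j} i<c with j <? x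
<col⇒box {x ∷ xs} dec {zero}  {j} i<c | yes j<x = j<x
<col⇒box {x ∷ xs} dec {suc i} {j} i<c | yes j<x
  rewrite filter-accept (j <?_) {x} {xs} j<x = <col⇒box (Linked.tail dec) (s≤s⁻¹ i<c)
<col⇒box {x ∷ xs} dec {i} {j} i<c | no j≮x
  rewrite filter-reject (j <?_) {x} {xs} j≮x =
  contradiction (<-≤-trans (<col⇒box (Linked.tail dec) i<c) (nth-bounded dec i)) j≮x

symmetric⇒selfConjugate : ∀ μ → Symmetric μ → SelfConjugate (row μ)
symmetric⇒selfConjugate μ sym-μ {i} {j} j<ri =
  subst (i <_) (sym (sym-μ j)) (box⇒<col (decreasing μ) j<ri)

selfConjugate⇒symmetric : ∀ μ → SelfConjugate (row μ) → Symmetric μ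
selfConjugate⇒symmetric μ sc i = ≤-antisym
  -- A row `i` longer than column `i` would contain the box `(i , col μ i)`, whose transpose lies in
  -- column `i` just past its end.
  (≮⇒≥ λ lt → <-irrefl refl (box⇒<col (decreasing μ) (sc lt)))
  (≮⇒≥ λ lt → <-irrefl refl (sc (<col⇒box (decreasing μ) lt)))

nth-applyUpTo-< : ∀ (f : ℕ → ℕ) {n i} → i < n → nth (applyUpTo f n) i ≡ f i
nth-applyUpTo-< f {suc n} {zero}  _         = refl
nth-applyUpTo-< f {suc n} {suc i} (s≤s i<n) = nth-applyUpTo-< (f ∘ suc) i<n

nth-applyUpTo-≥ : ∀ (f : ℕ → ℕ) {n i} → n ≤ i → nth (applyUpTo f n) i ≡ 0
nth-applyUpTo-≥ f {zero}          _         = refl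
nth-applyUpTo-≥ f {suc n} {suc i} (s≤s n≤i) = nth-applyUpTo-≥ (f ∘ suc) n≤i

-- By self-conjugacy `r 0` is also the number of nonempty rows.
toPartition : ∀ {r} → SelfConjugate r → Partition
toPartition {r} sc = record
  { parts      = applyUpTo r (r 0)
  ; decreasing = Linked.applyUpTo⁺₂ r (r 0) λ i → antitone sc (n≤1+n i)
  ; positive   = All.applyUpTo⁺₁ r (r 0) λ i<r0 → >-nonZero (sc i<r0)
  }

row-toPartition : ∀ {r} (sc : SelfConjugate r) i → row (toPartition sc) i ≡ r i
row-toPartition {r} sc i with i <? r 0
... | yes i<r0 = nth-applyUpTo-< r i<r0
... | no  i≮r0 = trans (nth-applyUpTo-≥ r (≮⇒≥ i≮r0)) (sym (r≡0 sc (≮⇒≥ i≮r0)))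

-- Positive parts differ from the default value `0` of `nth`, which therefore shows where a list
-- ends.
nth-injective : ∀ {xs ys} → All NonZero xs → All NonZero ys → nth xs ≗ nth ys → xs ≡ ys
nth-injective [] [] _ = refl
nth-injective {ys = zero ∷ _} [] (() ∷ _) _
nth-injective {ys = suc _ ∷ _} [] _ eq = contradiction (eq 0) λ ()
nth-injective {zero ∷ _} (() ∷ _) [] _
nth-injective {suc _ ∷ _} _ [] eq = contradiction (eq 0) λ ()
nth-injective (_ ∷ pxs) (_ ∷ pys) eq = cong₂ _∷_ (eq 0) (nth-injective pxs pys (eq ∘ suc))

parts-selfConjugate : ∀ μ → SelfConjugate (row μ) → parts μ ≡ applyUpTo (row μ) (row μ 0)
parts-selfConjugate μ sc = nth-injective (positive μ) (positive (toPartition sc))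
  (λ i → sym (row-toPartition sc i))

selfConjugate-cong : ∀ {r r′} → r ≗ r′ → SelfConjugate r → SelfConjugate r′
selfConjugate-cong eq sc {i} {j} lt =
  subst (i <_) (eq j) (sc (subst (j <_) (sym (eq i)) lt))

-- Abaci encoding a row function

Pointwise-applyUpTo : ∀ {A B : Set} {R : A → B → Set} (f : ℕ → A) (g : ℕ → B) →
  (∀ i → R (f i) (g i)) → ∀ n → Pointwise R (applyUpTo f n) (applyUpTo g n)
Pointwise-applyUpTo f g Rfg zero    = []
Pointwise-applyUpTo f g Rfg (suc n) = Rfg 0 ∷ Pointwise-applyUpTo (f ∘ suc) (g ∘ suc) (Rfg ∘ suc) n

-- For self-conjugate `r` these one-way implications determine `a`, because `classify` makes every
-- position a bead or a gap position.
record Encodes {n} (a : Abacus n) (r : ℕ → ℕ) : Set where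
  field
    isBead : ∀ {e} i → pos e ≡ beadPos r i → Bead a e
    isGap  : ∀ {e} j → pos e ≡ gapPos r j → Gap a e

open Encodes

Encodes-congˡ : ∀ {n} {a a′ : Abacus n} {r} → a ≗ a′ → Encodes a r → Encodes a′ r
Encodes-congˡ a≗ enc = record
  { isBead = λ {e} i eq → trans (sym (a≗ e)) (isBead enc i eq)
  ; isGap  = λ {e} j eq → trans (sym (a≗ e)) (isGap enc j eq)
  }

Encodes-congʳ : ∀ {n} {a : Abacus n} {r r′} → r ≗ r′ → Encodes a r → Encodes a r′
Encodes-congʳ r≗ enc = record
  { isBead = λ i eq → isBead enc i (trans eq (cong (_⊖ suc i) (sym (r≗ i))))
  ; isGap  = λ j eq → isGap enc j (trans eq (cong (j ⊖_) (sym (r≗ j))))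
  }

module _ {r : ℕ → ℕ} (sc : SelfConjugate r) where

  toAbacus : ∀ {n} → Abacus n
  toAbacus e = [ const true , const false ]′ (classify sc (pos e))

  toAbacus-encodes : ∀ {n} → Encodes (toAbacus {n}) r
  toAbacus-encodes .isBead {e} i eq with classify sc (pos e)
  ... | inj₁ _         = refl
  ... | inj₂ (j , eq′) = contradiction (trans (sym eq) eq′) (bead≢gap sc)
  toAbacus-encodes .isGap {e} j eq with classify sc (pos e)
  ... | inj₁ (i , eq′) = contradiction (trans (sym eq′) eq) (bead≢gap sc)
  ... | inj₂ _         = refl

  Encodes-unique : ∀ {n} {a a′ : Abacus n} → Encodes a r → Encodes a′ r → a ≗ a′
  Encodes-unique enc enc′ e with classify sc (pos e)
  ... | inj₁ (i , eq) = trans (isBead enc i eq) (sym (isBead enc′ i eq))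
  ... | inj₂ (j , eq) = trans (isGap enc j eq) (sym (isGap enc′ j eq))

module _ {n : ℕ} .{{_ : NonZero n}} {a : Abacus n} {r : ℕ → ℕ}
         (sc : SelfConjugate r) (enc : Encodes a r) where

  private
    B G : ℕ → Entry n
    B i = entryAt (beadPos r i)
    G j = entryAt (gapPos r j)

    pos-B : ∀ i → pos (B i) ≡ beadPos r i
    pos-B i = pos-entryAt (beadPos r i)

    pos-G : ∀ j → pos (G j) ≡ gapPos r j
    pos-G j = pos-entryAt (gapPos r j)

  bead⁻ : ∀ {e : Entry n} → Bead a e → ∃[ i ] pos e ≡ beadPos r i
  bead⁻ {e} be with classify sc (pos e)
  ... | inj₁ found    = found
  ... | inj₂ (j , eq) = contradiction (trans (sym be) (isGap enc j eq)) λ ()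

  gap⁻ : ∀ {e} → Gap a e → ∃[ j ] pos e ≡ gapPos r j
  gap⁻ {e} ge with classify sc (pos e)
  ... | inj₁ (i , eq) = contradiction (trans (sym ge) (isBead enc i eq)) λ ()
  ... | inj₂ found    = found

  G≺B : ∀ {i j} → j < r i → G j ≺ B i
  G≺B {i} {j} j<ri = pos<⇒≺ {e = G j} {f = B i}
    (subst₂ ℤ._<_ (sym (pos-G j)) (sym (pos-B i)) (box⇒gap<bead sc j<ri))

  gap≺bead⇒box : ∀ {g b : Entry n} {i j} → pos g ≡ gapPos r j → pos b ≡ beadPos r i → g ≺ b → j < r i
  gap≺bead⇒box {g} {b} g≡ b≡ g≺b =
    gap<bead⇒box sc (subst₂ ℤ._<_ g≡ b≡ (≺⇒pos< {e = g} {f = b} g≺b))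

  gaps-ascending : ∀ j → G j ≺ G (suc j)
  gaps-ascending j = pos<⇒≺ {e = G j} {f = G (suc j)}
    (subst₂ ℤ._<_ (sym (pos-G j)) (sym (pos-G (suc j))) (gap-increasing sc j))

  -- The gap of column `j` precedes the bead of row `i` exactly when `(i , j)` is a box, which
  -- leaves the first `r i` columns.
  gaps-before : ∀ i → HasSize (λ g → Gap a g × g ≺ B i) (r i)
  gaps-before i = applyUpTo G (r i) ,
    (Linked.applyUpTo⁺₂ G (r i) gaps-ascending , λ g → mk⇔ (to g) (from g)) ,
    length-applyUpTo G (r i)
    where
    to : ∀ g → Gap a g × g ≺ B i → g ∈ applyUpTo G (r i)
    to g (gap , g≺) with gap⁻ gap
    ... | j , eq = subst (_∈ applyUpTo G (r i)) (sym (entryAt-pos eq))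
                     (∈-applyUpTo⁺ G (gap≺bead⇒box {g} {B i} eq (pos-B i) g≺))

    from : ∀ g → g ∈ applyUpTo G (r i) → Gap a g × g ≺ B i
    from g g∈ with ∈-applyUpTo⁻ G g∈
    ... | j , j<ri , refl = isGap enc j (pos-G j) , G≺B j<ri

  -- A gap before the bead of row `i` is a box in that row, whence `i < r 0`; conversely the first
  -- gap `G 0` precedes the bead of every nonempty row. Bead positions fall with the row index, so
  -- reading order begins with the last nonempty row.
  active-beads : Enumerates (Active a) (applyDownFrom B (r 0))
  active-beads = Linked.applyDownFrom⁺₂ B (r 0) descending , λ e → mk⇔ (to e) (from e)
    where
    descending : ∀ i → B (suc i) ≺ B i
    descending i = pos<⇒≺ {e = B (suc i)} {f = B i}
      (subst₂ ℤ._<_ (sym (pos-B (suc i))) (sym (pos-B i)) (bead-decreasing sc i))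

    to : ∀ e → Active a e → e ∈ applyDownFrom B (r 0)
    to e (be , g , gg , g≺e) with bead⁻ be | gap⁻ gg
    ... | i , e≡ | j , g≡ = subst (_∈ applyDownFrom B (r 0)) (sym (entryAt-pos e≡))
      (∈-applyDownFrom⁺ B (sc (≤-<-trans z≤n (gap≺bead⇒box {g} {e} g≡ e≡ g≺e))))

    from : ∀ e → e ∈ applyDownFrom B (r 0) → Active a e
    from e e∈ with ∈-applyDownFrom⁻ B e∈
    ... | i , i<r0 , refl = isBead enc i (pos-B i) , G 0 , isGap enc 0 (pos-G 0) , G≺B (sc i<r0)

  𝒞-encoded : ∀ {μ} → parts μ ≡ applyUpTo r (r 0) → 𝒞 a μ
  𝒞-encoded eq = applyDownFrom B (r 0) , active-beads ,
    subst₂ (Pointwise _) (sym (reverse-applyDownFrom B (r 0))) (sym eq)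
      (Pointwise-applyUpTo B r gaps-before (r 0))

  gaps-before-N : HasSize (λ g → Gap a g × label g ℤ.< + N n)
                    (length (filter (λ i → i <? r i) (upTo (r 0))))
  gaps-before-N = map G diagonalBoxes ,
    (Linked.map⁺ (Linked.map G-mono (Linked.filter⁺ (λ i → i <? r i) <-trans
                    (Linked.applyUpTo⁺₂ _ (r 0) n<1+n)))
    , λ g → mk⇔ (to g) (from g)) ,
    length-map G diagonalBoxes
    where
    diagonalBoxes = filter (λ i → i <? r i) (upTo (r 0))

    G-mono : ∀ {i j} → i < j → G i ≺ G j
    G-mono {i} {suc j} (s≤s i≤j) with m≤n⇒m<n∨m≡n i≤j
    ... | inj₁ i<j  = ℤ.<-trans (G-mono i<j) (gaps-ascending j)
    ... | inj₂ refl = gaps-ascending i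

    to : ∀ g → Gap a g × label g ℤ.< + N n → g ∈ map G diagonalBoxes
    to g (gap , g<N) with gap⁻ gap
    ... | j , eq = subst (_∈ map G diagonalBoxes) (sym (entryAt-pos eq))
      (∈-map⁺ G (∈-filter⁺ (λ i → i <? r i) (∈-upTo⁺ (sc (≤-<-trans z≤n j<rj))) j<rj))
      where
      j<rj : j < r j
      j<rj = diagonal⁻ sc (subst (ℤ._< + 0) eq (precedes-N⇒pos<0 {e = g} g<N))

    from : ∀ g → g ∈ map G diagonalBoxes → Gap a g × label g ℤ.< + N n
    from g g∈ with ∈-map⁻ G g∈
    ... | j , j∈ , refl = isGap enc j (pos-G j) ,
      pos<0⇒precedes-N {e = G j} (subst (ℤ._< + 0) (sym (pos-G j))
        (diagonal sc (proj₂ (∈-filter⁻ (λ i → i <? r i) {xs = upTo (r 0)} j∈))))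

-- Flush, balanced and core

hookLength : (ℕ → ℕ) → ℕ → ℕ → ℕ
hookLength r i j = suc ((r i ∸ suc j) + (r j ∸ suc i))

-- With arm `p` and leg `q`, `r i = p + suc j` and `r j = q + suc i`; the indices cancel in the
-- difference of positions and leave `p + q + 1`.
bead-gap-distance : ∀ {r} → SelfConjugate r → ∀ {i j} → j < r i →
  beadPos r i ≡ gapPos r j ℤ.+ + hookLength r i j
bead-gap-distance {r} sc {i} {j} j<ri = trans
  (⊖-cong (r i) (suc i) (j + hookLength r i j) (r j) (begin
    r i + r j                    ≡⟨ cong₂ _+_ (m∸n+n≡m j<ri) (m∸n+n≡m (sc j<ri)) ⟨
    (p + suc j) + (q + suc i)    ≡⟨ rearrange p q i j ⟩
    j + suc (p + q) + suc i      ∎))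
  (sym (ℤ.distribˡ-⊖-+-pos (hookLength r i j) j (r j)))
  where
  open ≡-Reasoning
  p = r i ∸ suc j
  q = r j ∸ suc i
  rearrange : ∀ p q i j → (p + suc j) + (q + suc i) ≡ j + suc (p + q) + suc i
  rearrange = solve-∀

core-hookLength : ∀ {t} μ → Symmetric μ → Core t μ →
  ∀ {i j} → j < row μ i → ¬ (t ∣ hookLength (row μ) i j)
core-hookLength {t} μ sym-μ core {i} {j} j<ri t∣h = core i j j<ri
  (subst (λ c → t ∣ suc ((row μ i ∸ suc j) + (c ∸ suc i))) (sym-μ j) t∣h)

-- A discrete intermediate value argument: climbing from `m`, the first `false` has a `true`
-- directly before it.
transition : (P : ℤ → Bool) → ∀ k m → P m ≡ true → P (m ℤ.+ + k) ≡ false →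
             ∃[ l ] (P l ≡ true × P (ℤ.suc l) ≡ false)
transition P zero m pm pk = contradiction
  (trans (sym pm) (trans (cong P (sym (ℤ.+-identityʳ m))) pk)) λ ()
transition P (suc k) m pm pk with P (ℤ.suc m) in eq
... | false = m , pm , eq
... | true  = transition P k (ℤ.suc m) eq (trans (cong P (shift m (+ k))) pk)
  where
  shift : ∀ m k → + 1 ℤ.+ m ℤ.+ k ≡ m ℤ.+ (+ 1 ℤ.+ k)
  shift = ℤ.solve-∀

bounded : ∀ {m} (f : Fin m → ℕ) → ∃[ B ] (∀ i → f i ≤ B)
bounded {zero}  f = 0 , λ ()
bounded {suc m} f with bounded (f ∘ Fin.suc)
... | B , f≤B = f Fin.zero + B , λ where
  Fin.zero    → m≤m+n (f Fin.zero) B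
  (Fin.suc i) → ≤-trans (f≤B i) (m≤n+m B (f Fin.zero))

i≤+∣i∣ : ∀ i → i ℤ.≤ + ℤ.∣ i ∣
i≤+∣i∣ (+ n)    = ℤ.≤-refl
i≤+∣i∣ -[1+ n ] = ℤ.-≤+

module _ {n : ℕ} where

  -- The residues of opposite runners already add up to `N n`, so the level terms must cancel.
  opposite-levels : ∀ {i} {b c : Entry n} → runner b ≡ i → runner c ≡ opposite i →
    label b ℤ.+ label c ≡ + N n → level c ≡ ℤ.- level b
  opposite-levels {_} {entry i l} {entry _ m} refl refl sum = begin
    m                                ≡⟨ isolate l m ⟩
    (l ℤ.+ m) ℤ.- l                  ≡⟨ cong (ℤ._- l) (ℤ.*-cancelʳ-≡ (l ℤ.+ m) (+ 0) (+ N n) l+m≡0) ⟩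
    + 0 ℤ.- l                        ≡⟨ ℤ.+-identityˡ (ℤ.- l) ⟩
    ℤ.- l                            ∎
    where
    open ≡-Reasoning
    isolate : ∀ l m → m ≡ (l ℤ.+ m) ℤ.- l
    isolate = ℤ.solve-∀
    I K : ℤ
    I = + toℕ i
    K = + toℕ (opposite i)
    identity : ∀ l m d i k → (l ℤ.+ m) ℤ.* d ≡
      (l ℤ.* d ℤ.+ (+ 1 ℤ.+ i)) ℤ.+ (m ℤ.* d ℤ.+ (+ 1 ℤ.+ k)) ℤ.- (+ 1 ℤ.+ (k ℤ.+ (+ 1 ℤ.+ i)))
    identity = ℤ.solve-∀
    l+m≡0 : (l ℤ.+ m) ℤ.* + N n ≡ + 0 ℤ.* + N n
    l+m≡0 = begin
      (l ℤ.+ m) ℤ.* + N n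
        ≡⟨ identity l m (+ N n) I K ⟩
      (l ℤ.* + N n ℤ.+ (+ 1 ℤ.+ I)) ℤ.+ (m ℤ.* + N n ℤ.+ (+ 1 ℤ.+ K)) ℤ.- (+ 1 ℤ.+ (K ℤ.+ (+ 1 ℤ.+ I)))
        ≡⟨ cong₂ ℤ._-_ sum (cong (λ x → + suc x) (opposite-+ {n} i)) ⟩
      + N n ℤ.- + N n
        ≡⟨ ℤ.+-inverseʳ (+ N n) ⟩
      + 0 ∎

  module _ {a : Abacus n} where

    bead-above-lowest : Flush a → ∀ {i b e} → LowestBead a i b → runner e ≡ i →
                        level e ℤ.≤ level b → Bead a e
    bead-above-lowest flush {i} {b} {e} (rb , bb , _) re le with a e in ae
    ... | true = refl
    ... | false with ℤ.<-cmp (level e) (level b)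
    ...   | tri< lt _ _ = contradiction (level-<⇒≺ {e = e} {f = b} lt) (flush e b (trans re (sym rb)) ae bb)
    ...   | tri> _ _ gt = contradiction le (ℤ.<⇒≱ gt)
    ...   | tri≈ _ eq _ = trans (sym ae) (trans (cong a (cong₂ entry (trans re (sym rb)) eq)) bb)

    gap-below-lowest : ∀ {i b e} → LowestBead a i b → runner e ≡ i →
                       level b ℤ.< level e → Gap a e
    gap-below-lowest {i} {b} {e} (_ , _ , lowest) re lt with a e in ae
    ... | false = refl
    ... | true  = contradiction (lowest e re ae) (ℤ.<⇒≱ (level-<⇒≺ {e = b} {f = e} lt))

    -- On a flush runner the beads fill exactly the levels up to the lowest bead. If that level is
    -- `l`, it is `- l` on the opposite runner, and `m ≤ l` fails exactly when `1 - m ≤ - l`.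
    balancedFlush⇒mirror : BalancedFlush a → ∀ e → a (mirror e) ≡ not (a e)
    balancedFlush⇒mirror ((_ , balanced) , flush) e
      with balanced (runner e)
    ... | b , c , lb , lc , sum with level e ℤ.≤? level b
    ...   | yes le = trans (gap-below-lowest lc refl below)
                       (cong not (sym (bead-above-lowest flush lb refl le)))
      where
      below : level c ℤ.< + 1 ℤ.- level e
      below = ℤ.suc[i]≤j⇒i<j (subst (λ m → ℤ.suc m ℤ.≤ + 1 ℤ.- level e)
        (sym (opposite-levels {b = b} {c = c} (proj₁ lb) (proj₁ lc) sum))
        (ℤ.+-monoʳ-≤ (+ 1) (ℤ.neg-mono-≤ le)))
    ...   | no  ≰ = trans (bead-above-lowest flush lc refl above)
                       (cong not (sym (gap-below-lowest lb refl (ℤ.≰⇒> ≰))))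
      where
      above : + 1 ℤ.- level e ℤ.≤ level c
      above = subst (+ 1 ℤ.- level e ℤ.≤_)
        (sym (opposite-levels {b = b} {c = c} (proj₁ lb) (proj₁ lc) sum))
        (ℤ.i<j⇒suc[i]≤j (ℤ.neg-mono-< (ℤ.≰⇒> ≰)))

    -- A bead further along the runner would follow the gap at level `ℤ.suc m`, or else have a level
    -- strictly between `m` and `ℤ.suc m`.
    transition⇒lowestBead : Flush a → ∀ {i m} → Bead a (entry i m) → Gap a (entry i (ℤ.suc m)) →
                            LowestBead a i (entry i m)
    transition⇒lowestBead flush {i} {m} be ga = refl , be , λ c rc bc →
      ℤ.≮⇒≥ λ b≺c → lowest c rc bc b≺c
      where
      lowest : ∀ c → runner c ≡ i → Bead a c → ¬ (entry i m ≺ c)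
      lowest (entry _ l) refl bc b≺c with ℤ.<-cmp (ℤ.suc m) l
      ... | tri< lt _ _   = flush (entry i (ℤ.suc m)) (entry i l) refl ga bc
                               (level-<⇒≺ {n} {entry i (ℤ.suc m)} {entry i l} lt)
      ... | tri≈ _ refl _ = contradiction (trans (sym bc) ga) λ ()
      ... | tri> _ _ gt with digit-<⁻ (N n) m l (s≤s (Fin.toℕ<n i)) b≺c
      ...   | inj₁ m<l       = ℤ.<⇒≱ gt (ℤ.i<j⇒suc[i]≤j m<l)
      ...   | inj₂ (_ , i<i) = <-irrefl refl i<i

module _ {n : ℕ} .{{_ : NonZero n}} {a : Abacus n} where

  private
    w = 2 * n

  gaps-eventually : BalancedFlush a → ∃[ K ] (∀ k → K ≤ k → a (entryAt (+ k)) ≡ false)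
  -- `proj₁ bound` is at least the level of every lowest bead, and the next level starts at position
  -- `proj₁ bound * w`.
  gaps-eventually ((_ , balanced) , flush) = proj₁ bound * w , λ k K≤k →
    gap-below-lowest {b = lowest (runner (at k))} (isLowest (runner (at k))) refl (deep k K≤k)
    where
    lowest : Fin w → Entry n
    lowest i = proj₁ (balanced i)
    isLowest : ∀ i → LowestBead a i (lowest i)
    isLowest i = proj₁ (proj₂ (proj₂ (balanced i)))
    bound = bounded (λ i → ℤ.∣ level (lowest i) ∣)
    at : ℕ → Entry n
    at k = entryAt (+ k)
    deep : ∀ k → proj₁ bound * w ≤ k → level (lowest (runner (at k))) ℤ.< level (at k)
    deep k K≤k = ℤ.≤-<-trans
      (ℤ.≤-trans (i≤+∣i∣ _) (ℤ.+≤+ (proj₂ bound (runner (at k)))))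
      (ℤ.≰⇒> λ l≤B → ℤ.<⇒≱ (before l≤B) (ℤ.+≤+ K≤k))
      where
      B = proj₁ bound
      before : level (at k) ℤ.≤ + B → + k ℤ.< + (B * w)
      before l≤B = subst₂ ℤ._<_ (pos-entryAt (+ k))
        (trans (ℤ.+-identityʳ (+ B ℤ.* + w)) (sym (ℤ.pos-* B w)))
        (digit-< w (ℤ.pred (level (at k))) (+ B) 0 (Fin.toℕ<n (runner (at k)))
          (ℤ.suc[i]≤j⇒i<j (subst (ℤ._≤ + B) (sym (ℤ.suc-pred (level (at k)))) l≤B)))

  balancedFlush⇒encodes : BalancedFlush a → ∃[ r ] (SelfConjugate r × Encodes a r)
  balancedFlush⇒encodes bf = r , sc , record
    { isBead = λ i eq → trans (cong a (entryAt-pos eq)) (beads i)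
    ; isGap  = λ j eq → trans (cong a (entryAt-pos eq)) (gap-from-bead anti r (beads j))
    }
    where
    anti : ∀ x → a (entryAt (reflect x)) ≡ not (a (entryAt x))
    anti x = trans
      (cong a (sym (entryAt-pos (trans (pos-mirror (entryAt x)) (cong reflect (pos-entryAt x))))))
      (balancedFlush⇒mirror bf (entryAt x))
    eventually = gaps-eventually bf
    decoded = rows anti (proj₁ eventually) (proj₂ eventually)
    r = proj₁ decoded
    sc = λ {i} {j} → proj₁ (proj₂ decoded) {i} {j}
    beads = proj₂ (proj₂ decoded)

  module _ {r : ℕ → ℕ} (sc : SelfConjugate r) (enc : Encodes a r) where

    flush⇒core : Flush a → ∀ {i j} → j < r i → ¬ (w ∣ hookLength r i j)
    flush⇒core flush {i} {j} j<ri w∣h =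
      flush G B
        (∣⇒sameRunner {e = G} {f = B} w∣h (begin
          pos B                              ≡⟨ pos-entryAt _ ⟩
          beadPos r i                        ≡⟨ bead-gap-distance sc j<ri ⟩
          gapPos r j ℤ.+ + hookLength r i j  ≡⟨ cong (ℤ._+ + hookLength r i j) (pos-entryAt {n} (gapPos r j)) ⟨
          pos G ℤ.+ + hookLength r i j       ∎))
        (isGap enc j (pos-entryAt _)) (isBead enc i (pos-entryAt _)) (G≺B sc enc j<ri)
      where
      open ≡-Reasoning
      B G : Entry n
      B = entryAt (beadPos r i)
      G = entryAt (gapPos r j)

    core⇒flush : (∀ {i j} → j < r i → ¬ (w ∣ hookLength r i j)) → Flush a
    core⇒flush core g b same gg bb g≺b with gap⁻ sc enc gg | bead⁻ sc enc bb
    ... | j , g≡ | i , b≡ = core j<ri (sameRunner⇒∣ {e = g} {f = b} same (begin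
        pos b                              ≡⟨ b≡ ⟩
        beadPos r i                        ≡⟨ bead-gap-distance sc j<ri ⟩
        gapPos r j ℤ.+ + hookLength r i j  ≡⟨ cong (ℤ._+ + hookLength r i j) g≡ ⟨
        pos g ℤ.+ + hookLength r i j       ∎))
      where
      open ≡-Reasoning
      j<ri = gap≺bead⇒box sc enc {g} {b} g≡ b≡ g≺b

    encodes⇒mirror : ∀ e → a (mirror e) ≡ not (a e)
    encodes⇒mirror e with classify sc (pos e)
    ... | inj₁ (i , eq) = trans
      (isGap enc i (trans (pos-mirror e) (trans (cong reflect eq) (reflect-beadPos r i))))
      (cong not (sym (isBead enc i eq)))
    ... | inj₂ (j , eq) = trans
      (isBead enc j (trans (pos-mirror e) (trans (cong reflect eq) (reflect-gapPos r j))))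
      (cong not (sym (isGap enc j eq)))

    -- A bead at level `m` followed by a gap at `m + 1` on a runner reflects to a gap at `1 - m`
    -- preceded by a bead at `- m` on the opposite runner. One transition thus yields both lowest
    -- beads, with opposite levels.
    flush⇒balanced : Flush a → Balanced a
    flush⇒balanced flush =
      (λ i → entry i (m i) , refl , bead i) ,
      (λ i → entry {n} i (m i) , entry {n} (opposite i) (ℤ.- m i) ,
             transition⇒lowestBead {n} flush (bead i) (gap i) ,
             transition⇒lowestBead {n} flush (bead′ i) (gap′ i) , labels i)
      where
      K = r 0

      -- Level `suc K` starts at position `K * w`, which is at least `r 0`; from there on every
      -- column is empty and its gap sits at its own index.
      first-gap : ∀ i → Gap a (entry i (+ suc K))
      first-gap i = isGap enc (K * w + toℕ i) (begin
        + K ℤ.* + w ℤ.+ + toℕ i    ≡⟨ cong (ℤ._+ + toℕ i) (ℤ.pos-* K w) ⟨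
        + (K * w + toℕ i)          ≡⟨ cong (K * w + toℕ i ⊖_)
                                        (r≡0 sc (≤-trans (m≤m*n K w) (m≤m+n (K * w) (toℕ i)))) ⟨
        gapPos r (K * w + toℕ i)   ∎)
        where
        open ≡-Reasoning
        instance _ = m*n≢0 2 n

      opposite-gap⇒bead : ∀ i m → Gap a (entry (opposite i) m) → Bead a (entry i (+ 1 ℤ.- m))
      opposite-gap⇒bead i m gap = begin
        a (entry i (+ 1 ℤ.- m))               ≡⟨ cong (λ k → a (entry k (+ 1 ℤ.- m)))
                                                   (Fin.opposite-involutive i) ⟨
        a (mirror (entry (opposite i) m))     ≡⟨ encodes⇒mirror _ ⟩
        not (a (entry (opposite i) m))        ≡⟨ cong not gap ⟩
        true                                  ∎
        where open ≡-Reasoning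

      step : ∀ i → ∃[ m ] (Bead a (entry i m) × Gap a (entry i (ℤ.suc m)))
      -- The gap at level `suc K` of the opposite runner reflects to a bead at level `1 - suc K`;
      -- climbing `K + suc K` levels from it reaches the gap at `suc K`.
      step i = transition (λ m → a (entry i m)) (K + suc K) (+ 1 ℤ.- + suc K)
        (opposite-gap⇒bead i (+ suc K) (first-gap (opposite i)))
        (trans (cong (λ m → a (entry i m)) (top (+ K))) (first-gap i))
        where
        top : ∀ k → + 1 ℤ.- (+ 1 ℤ.+ k) ℤ.+ (k ℤ.+ (+ 1 ℤ.+ k)) ≡ + 1 ℤ.+ k
        top = ℤ.solve-∀

      m : Fin w → ℤ
      m i = proj₁ (step i)

      bead : ∀ i → Bead a (entry i (m i))
      bead i = proj₁ (proj₂ (step i))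

      gap : ∀ i → Gap a (entry i (ℤ.suc (m i)))
      gap i = proj₂ (proj₂ (step i))

      bead′ : ∀ i → Bead a (entry (opposite i) (ℤ.- m i))
      bead′ i = begin
        a (entry (opposite i) (ℤ.- m i))      ≡⟨ cong (λ l → a (entry (opposite i) l)) (level≡ (m i)) ⟩
        a (mirror (entry i (ℤ.suc (m i))))    ≡⟨ encodes⇒mirror _ ⟩
        not (a (entry i (ℤ.suc (m i))))       ≡⟨ cong not (gap i) ⟩
        true                                  ∎
        where
        open ≡-Reasoning
        level≡ : ∀ m → ℤ.- m ≡ + 1 ℤ.- (+ 1 ℤ.+ m)
        level≡ = ℤ.solve-∀

      gap′ : ∀ i → Gap a (entry (opposite i) (ℤ.suc (ℤ.- m i)))
      gap′ i = trans (encodes⇒mirror (entry i (m i))) (cong not (bead i))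

      labels : ∀ i → label (entry {n} i (m i)) ℤ.+ label (entry {n} (opposite i) (ℤ.- m i)) ≡ + N n
      labels i = trans (identity (m i) (+ N n) (+ toℕ i) (+ toℕ (opposite i)))
                       (cong (λ x → + suc x) (opposite-+ {n} i))
        where
        identity : ∀ l d i k → (l ℤ.* d ℤ.+ (+ 1 ℤ.+ i)) ℤ.+ (ℤ.- l ℤ.* d ℤ.+ (+ 1 ℤ.+ k)) ≡
                   + 1 ℤ.+ (k ℤ.+ (+ 1 ℤ.+ i))
        identity = ℤ.solve-∀

-- The bijections

-- This relation implies `𝒞 a μ`, and under it each of `a` and `μ` determines the other, which makes
-- it usable in both directions.
Corresponds : ∀ {n} → Abacus n → Partition → Set
Corresponds a μ = SelfConjugate (row μ) × Encodes a (row μ)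

module _ {n : ℕ} .{{_ : NonZero n}} where

  corresponds⇒𝒞 : ∀ {a : Abacus n} μ → Corresponds a μ → 𝒞 a μ
  corresponds⇒𝒞 μ (sc , enc) = 𝒞-encoded sc enc {μ} (parts-selfConjugate μ sc)

  -- It suffices that `Corresponds` is total on both sides: single-valuedness of `𝒞` makes the image
  -- well defined and turns `decode` into surjectivity, and `Encodes-unique` gives injectivity.
  restrictsToBijection : {P : Abacus n → Set} {Q : Partition → Set} →
    (∀ a → P a → ∃[ μ ] (Q μ × Corresponds a μ)) →
    (∀ μ → Q μ → ∃[ a ] (P a × Corresponds a μ)) →
    𝒞-RestrictsToBijection P Q
  restrictsToBijection {P} {Q} encode decode = record
    { to        = λ (a , p) → image a p , proj₁ (proj₂ (encode a p))
    ; cong      = λ {(a , p)} {(a′ , p′)} a≗a′ →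
        agree (image a p) (image a′ p′) a≗a′ (corr a p) (corr a′ p′)
    ; bijective =
        (λ {(a , p)} {(a′ , p′)} → injective a p a′ p′) ,
        λ (μ , q) → let (a , p , c) = decode μ q in
          (a , p) , λ {(a′ , p′)} a′≗a → agree (image a′ p′) μ a′≗a (corr a′ p′) c
    } , λ a p μ → mk⇔
      (𝒞-functional {μ = image a p} {ν = μ} (corresponds⇒𝒞 (image a p) (corr a p)))
      (λ eq → 𝒞-encoded (proj₁ (corr a p)) (proj₂ (corr a p)) {μ}
        (trans (sym eq) (parts-selfConjugate (image a p) (proj₁ (corr a p)))))
    where
    image : ∀ a → P a → Partition
    image a p = proj₁ (encode a p)

    corr : ∀ a p → Corresponds a (image a p)
    corr a p = proj₂ (proj₂ (encode a p))

    agree : ∀ {a a′ : Abacus n} μ ν → a ≗ a′ → Corresponds a μ → Corresponds a′ ν → parts μ ≡ parts ν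
    agree μ ν a≗a′ c (sc , enc) = 𝒞-functional {μ = μ} {ν = ν} (corresponds⇒𝒞 μ c)
      (corresponds⇒𝒞 ν (sc , Encodes-congˡ (sym ∘ a≗a′) enc))

    injective : ∀ a p a′ p′ → parts (image a p) ≡ parts (image a′ p′) → a ≗ a′
    injective a p a′ p′ eq = Encodes-unique (proj₁ (corr a p)) (proj₂ (corr a p))
      (subst (λ xs → Encodes a′ (nth xs)) (sym eq) (proj₂ (corr a′ p′)))

  encodes⇒symmetricCore : ∀ {a : Abacus n} → Flush a → ∃[ r ] (SelfConjugate r × Encodes a r) →
    ∃[ μ ] (SymmetricCore (2 * n) μ × Corresponds a μ)
  encodes⇒symmetricCore {a} flush (r , sc , enc) = μ , (sym-μ , core) , sc-μ , enc-μ
    where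
    μ : Partition
    μ = toPartition sc
    r≗row : r ≗ row μ
    r≗row i = sym (row-toPartition sc i)
    sc-μ : SelfConjugate (row μ)
    sc-μ = selfConjugate-cong r≗row sc
    enc-μ : Encodes a (row μ)
    enc-μ = Encodes-congʳ r≗row enc
    sym-μ : Symmetric μ
    sym-μ = selfConjugate⇒symmetric μ sc-μ
    core : Core (2 * n) μ
    core i j j<ri w∣h = flush⇒core sc-μ enc-μ flush j<ri
      (subst (λ c → 2 * n ∣ suc ((row μ i ∸ suc j) + (c ∸ suc i))) (sym (sym-μ j)) w∣h)

  balancedFlush⇒symmetricCore : ∀ a → BalancedFlush a →
    ∃[ μ ] (SymmetricCore (2 * n) μ × Corresponds {n} a μ)
  balancedFlush⇒symmetricCore a bf =
    encodes⇒symmetricCore (proj₂ bf) (balancedFlush⇒encodes bf)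

  symmetricCore⇒balancedFlush : ∀ μ → SymmetricCore (2 * n) μ →
    ∃[ a ] (BalancedFlush a × Corresponds {n} a μ)
  symmetricCore⇒balancedFlush μ (sym-μ , core) =
    toAbacus sc , (flush⇒balanced sc enc flush , flush) , sc , enc
    where
    sc : SelfConjugate (row μ)
    sc = symmetric⇒selfConjugate μ sym-μ
    enc : Encodes (toAbacus {row μ} sc {n}) (row μ)
    enc = toAbacus-encodes sc
    flush : Flush (toAbacus {row μ} sc {n})
    flush = core⇒flush sc enc λ {i} {j} → core-hookLength μ sym-μ core {i} {j}

  gaps-before-N-diagonal : ∀ {a : Abacus n} μ → Corresponds a μ →
    HasSize (λ g → Gap a g × label g ℤ.< + N n)
            (length (filter (λ i → i <? row μ i) (upTo (length (parts μ)))))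
  -- `EvenPartition` scans as many rows as there are parts, which by self-conjugacy is `row μ 0`.
  gaps-before-N-diagonal μ (sc , enc) = subst
    (λ l → HasSize _ (length (filter (λ i → i <? row μ i) (upTo l))))
    (sym (trans (cong length (parts-selfConjugate μ sc)) (length-applyUpTo (row μ) (row μ 0))))
    (gaps-before-N sc enc)

  evenAbacus⇒evenPartition : ∀ {a : Abacus n} μ → Corresponds a μ → EvenAbacus a → EvenPartition μ
  evenAbacus⇒evenPartition μ c (k , size , 2∣k) =
    subst (2 ∣_) (HasSize-unique size (gaps-before-N-diagonal μ c)) 2∣k

  evenPartition⇒evenAbacus : ∀ {a : Abacus n} μ → Corresponds a μ → EvenPartition μ → EvenAbacus a
  evenPartition⇒evenAbacus μ c even = _ , gaps-before-N-diagonal μ c , even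

proposition5p4 : (n : ℕ) .{{_ : NonZero n}} →
    𝒞-RestrictsToBijection {n} BalancedFlush (SymmetricCore (2 * n)) ×
    𝒞-RestrictsToBijection {n} EvenBalancedFlush (EvenSymmetricCore (2 * n))
proposition5p4 n =
  restrictsToBijection balancedFlush⇒symmetricCore symmetricCore⇒balancedFlush ,
  restrictsToBijection
    (λ a (even , bf) → let (μ , core , c) = balancedFlush⇒symmetricCore a bf in
      μ , (evenAbacus⇒evenPartition μ c even , core) , c)
    (λ μ (even , core) → let (a , bf , c) = symmetricCore⇒balancedFlush μ core in
      a , (evenPartition⇒evenAbacus μ c even , bf) , c)
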